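{- Let $\sigma$ be a switch table for a subgroup $G$ of $\mathrm{Sym}(n)$. Let $1\le i\le n$ and let $G_{i-1}$ be the point-wise stabilizer of $[i-1]$ in $G$. Let $S$ and $S'$ be subsets of $[n]\setminus[i-1]$ with identical cardinality. Then: (i) If $S=\emptyset$ or $S=[n]\setminus[i-1]$, then there is no permutation $g\in G_{i-1}$ with $g(S')\prec S$. (ii) If $G$ is the trivial group or $i>\max R$, where $R$ is the effective row set of $\sigma$, then there is a permutation $g\in G_{i-1}$ with $g(S')\prec S$ if and only if $S'\prec S$. (iii) If $i\in S$: if (a) $i\in S'$ and there is a permutation $g'\in G_i$ with $g'(S'\setminus\{i\})\prec S\setminus\{i\}$, or (b) there is a non-trivial switch $\sigma_{i,j}$ with $j\in S'$ and a permutation $g'\in G_i$ with $g'\bigl(\sigma_{i,j}(S'\setminus\{j\})\bigr)\prec S\setminus\{i\}$, then there is a permutation $g\in G_{i-1}$ with $g(S')\prec S$. If neither (a) nor (b) occurs, then there is no permutation $g\in G_{i-1}$ with $g(S')\prec S$. (iv) If $i\notin S$: if (a) $i\in S'$, or (b) $C(i)\cap S'\neq\emptyset$, where $C(i)$ is the effective column set of row $i$, or (c) there is a permutation $g'\in G_i$ with $g'(S')\prec S$, or (d) there is a switch $\sigma_{i,j}$ with $j\notin S'$ and a permutation $g'\in G_i$ with $g'\bigl(\sigma_{i,j}(S')\bigr)\prec S$, then there is a permutation $g\in G_{i-1}$ with $g(S')\prec S$. If none of these four cases occurs, then there is no permutation $g\in G_{i-1}$ with $g(S')\prec S$. In particular,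 for $i=1$ and $S'=S$ these conditions characterize whether there is a permutation $g\in G$ with $g(S)\prec S$.
   Context: $[n]=\{1,\dots,n\}$, $[0]=\emptyset$. Permutations act on subsets elementwise. Lexicographic order on subsets: $\emptyset\prec S$ for $S\neq\emptyset$, and for non-empty $S,R$: $S\prec R$ iff $\min S<\min R$, or $\min S=\min R$ and $S\setminus\{\min S\}\prec R\setminus\{\min R\}$. $G_i$ denotes the point-wise stabilizer $\{g\in G: g(k)=k\text{ for all }k\le i\}$, so $G_0=G$. A switch table for $G$ is a function $\sigma:[n]\times[n]\to G$, $(i,j)\mapsto\sigma_{i,j}$, such that for $j>i$, if some $g\in G$ satisfies $g(j)=i$ and $g(k)=k$ for all $k<i$, then $\sigma_{i,j}$ is one such $g$; in all other cases $\sigma_{i,j}=\mathrm{id}$. The entries are called switches; an entry is trivial if it is the identity. A row $i$ is effective if it contains at least one non-trivial switch; the effective row set $R$ is the set of indices of effective rows, with $\max R=-\infty$ if $R=\emptyset$. The effective column set $C(i)$ of row $i$ is the set of column indices $j$ of non-trivial switches $\sigma_{i,j}$ (empty if row $i$ is not effective). -}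

module Defs where

open import Data.Bool.Base using (if_then_else_)
open import Data.Fin.Base using (Fin; zero; suc; toℕ; _≤_; _<_)
open import Data.Fin.Permutation
  using (Permutation′; _⟨$⟩ʳ_; _≈_; id; flip; _∘ₚ_)
open import Data.Fin.Properties using (_≟_; all?; any?)
open import Data.Fin.Subset
  using (Subset; _∈_; _∉_; Nonempty; Empty; Lift; _∩_; _-_)
open import Data.Fin.Subset.Properties using (_∈?_)
import Data.Nat.Base as ℕ
import Data.Nat.Properties as ℕ
open import Data.Nat.Base using (ℕ)
open import Data.Product.Base using (∃; _×_)
open import Data.Sum.Base using (_⊎_)
open import Data.Vec.Base using ([]; _∷_; tabulate)
open import Level using (Level) renaming (suc to ℓsuc)
open import Relation.Binary.Construct.Add.Infimum.Strict
  using () renaming (_<₋_ to Lift-<₋)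
open import Relation.Binary.PropositionalEquality.Core using (_≡_)
open import Relation.Nullary using (¬_; Dec; does; ¬?)
open import Relation.Nullary.Construct.Add.Infimum using (_₋; ⊥₋; [_])
open import Relation.Nullary.Decidable using (_×-dec_)
open import Relation.Unary using (Pred; Decidable)

private
  variable
    ℓ : Level
    n : ℕ

-- The set {1,…,n} is represented by Fin n, so the number k is the element
-- whose toℕ is k − 1.

comprehension : {P : Pred (Fin n) ℓ} → Decidable P → Subset n
comprehension P? = tabulate (λ k → does (P? k))

-- [m] ∩ [n]; here always used with m ≤ n.
initial : (m : ℕ) → Subset n
initial m = comprehension (λ k → toℕ k ℕ.<? m)

infixr 8 _·_

_·_ : Permutation′ n → Subset n → Subset n
g · S = comprehension (λ x → any? (λ s → (s ∈? S) ×-dec (g ⟨$⟩ʳ s ≟ x)))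

IsMin : Fin n → Subset n → Set
IsMin m S = m ∈ S × Lift (m ≤_) S

infix 4 _≺_

data _≺_ {n : ℕ} : Subset n → Subset n → Set where
  ∅≺   : ∀ {S R} → Empty S → Nonempty R → S ≺ R
  min< : ∀ {S R s r} → IsMin s S → IsMin r R → s < r → S ≺ R
  min≡ : ∀ {S R m} → IsMin m S → IsMin m R → S - m ≺ R - m → S ≺ R

-- The value ⊥₋ plays the role of −∞.
max : Subset n → Fin n ₋
max []      = ⊥₋
max (x ∷ S) with max S
... | [ k ] = [ suc k ]
... | ⊥₋    = if x then [ zero ] else ⊥₋

infix 4 _<₋_

_<₋_ : Fin n ₋ → Fin n ₋ → Set
_<₋_ = Lift-<₋ _<_

-- Permutations are compared by their values, so membership has to respect _≈_.
record Subgroup (n : ℕ) (ℓ : Level) : Set (ℓsuc ℓ) where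
  field
    Member    : Pred (Permutation′ n) ℓ
    resp-≈    : ∀ {g h} → g ≈ h → Member g → Member h
    id-closed : Member id
    ∘-closed  : ∀ {g h} → Member g → Member h → Member (g ∘ₚ h)
    ⁻¹-closed : ∀ {g} → Member g → Member (flip g)

open Subgroup public using (Member)

IsTrivial : Permutation′ n → Set
IsTrivial g = g ≈ id

isTrivial? : (g : Permutation′ n) → Dec (IsTrivial g)
isTrivial? g = all? (λ k → g ⟨$⟩ʳ k ≟ k)

IsTrivialGroup : Subgroup n ℓ → Set ℓ
IsTrivialGroup G = ∀ {g} → Member G g → IsTrivial g

-- Stabilizer G m is the point-wise stabilizer G_m of {1,…,m}. For i : Fin n,
-- which stands for the number toℕ i + 1, the group G_{i−1} is therefore
-- Stabilizer G (toℕ i), and G_i is Stabilizer G (suc (toℕ i)).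
Stabilizer : Subgroup n ℓ → ℕ → Pred (Permutation′ n) ℓ
Stabilizer G m g = Member G g × (∀ k → toℕ k ℕ.< m → g ⟨$⟩ʳ k ≡ k)

CanPrecede : Pred (Permutation′ n) ℓ → Subset n → Subset n → Set ℓ
CanPrecede H T U = ∃ λ g → H g × g · T ≺ U

MapsFixingBelow : Fin n → Fin n → Permutation′ n → Set
MapsFixingBelow i j g = g ⟨$⟩ʳ j ≡ i × (∀ k → k < i → g ⟨$⟩ʳ k ≡ k)

record SwitchTable {n : ℕ} {ℓ : Level} (G : Subgroup n ℓ) : Set ℓ where
  field
    switch : Fin n → Fin n → Permutation′ n
    member : ∀ i j → Member G (switch i j)

  Required : Fin n → Fin n → Set ℓ
  Required i j = i < j × ∃ λ g → Member G g × MapsFixingBelow i j g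

  field
    required  : ∀ {i j} → Required i j → MapsFixingBelow i j (switch i j)
    otherwise : ∀ {i j} → ¬ Required i j → IsTrivial (switch i j)

  NonTrivialAt : Fin n → Fin n → Set
  NonTrivialAt i j = ¬ IsTrivial (switch i j)

  nonTrivialAt? : ∀ i j → Dec (NonTrivialAt i j)
  nonTrivialAt? i j = ¬? (isTrivial? (switch i j))

  effectiveRows : Subset n
  effectiveRows = comprehension (λ i → any? (nonTrivialAt? i))

  effectiveColumns : Fin n → Subset n
  effectiveColumns i = comprehension (nonTrivialAt? i)

-- The In-cases are the alternatives for i ∈ S, the Out-cases those for i ∉ S.
module _ {G : Subgroup n ℓ} (σ : SwitchTable G)
         (i : Fin n) (S S′ : Subset n) where
  open SwitchTable σ

  private
    Gᵢ : Pred (Permutation′ n) ℓ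
    Gᵢ = Stabilizer G (ℕ.suc (toℕ i))

  In-a In-b : Set ℓ
  In-a = i ∈ S′ × CanPrecede Gᵢ (S′ - i) (S - i)
  In-b = ∃ λ j → NonTrivialAt i j × j ∈ S′ ×
                 CanPrecede Gᵢ (switch i j · (S′ - j)) (S - i)

  Out-a Out-b : Set
  Out-a = i ∈ S′
  Out-b = Nonempty (effectiveColumns i ∩ S′)

  Out-c Out-d : Set ℓ
  Out-c = CanPrecede Gᵢ S′ S
  Out-d = ∃ λ j → j ∉ S′ × CanPrecede Gᵢ (switch i j · S′) S

  InCases OutCases : Set ℓ
  InCases  = In-a ⊎ In-b
  OutCases = Out-a ⊎ Out-b ⊎ Out-c ⊎ Out-d

{-# OPTIONS --safe #-}
module Submission where

-- If g fixes everything below i and g j ≡ i, then g and any other such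
-- permutation h differ by an element of Gᵢ, so g(T) = g′(h(T)) with g′ ∈ Gᵢ.
-- As h one can take the identity when j ≡ i and the switch σᵢⱼ when j > i.
-- Applying this to the element j that g moves to i, the comparison of g(S′)
-- with S is decided by whether i belongs to the two sets.

open import Defs
open import Level using (Level)
open import Data.Nat.Base using (ℕ)
open import Data.Fin.Base using (Fin; toℕ)
open import Data.Fin.Subset using (Subset; _∈_; _∉_; _⊆_; ⊥; ⊤; ∁; ∣_∣)
open import Data.Product.Base using (_×_)
open import Data.Sum.Base using (_⊎_)
open import Function.Bundles using (_⇔_)
open import Relation.Binary.PropositionalEquality using (_≡_)
open import Relation.Nullary using (¬_)
open import Relation.Nullary.Construct.Add.Infimum using ([_])

open import Data.Bool.Base using (true; false)
open import Data.Fin.Base using (zero; suc; _≤_; _<_)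
open import Data.Fin.Induction using (<-wellFounded)
open import Data.Fin.Permutation
  using (Permutation′; _⟨$⟩ʳ_; id; flip; _∘ₚ_; inverseˡ; inverseʳ)
open import Data.Fin.Properties
  using (_≟_; all?; any?; ≤-antisym; ≤∧≢⇒<; <⇒≢)
open import Data.Fin.Subset using (Nonempty; Lift; _─_; _-_)
open import Data.Fin.Subset.Properties
  using ( _∈?_; nonempty?; Empty-unique; ∉⊥; ∣⊥∣≡0; ⊆⊤; ⊆-antisym; p⊂q⇒∣p∣<∣q∣
        ; x∈∁p⇒x∉p; x∉p⇒x∈∁p; x∈p∩q⁺; x∈p∩q⁻; x∈⁅x⁆; p─q⊆p
        ; x∈p∧x≢y⇒x∈p-y; x∈p⇒∣p-x∣<∣p∣)
import Data.Nat.Base as ℕ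
import Data.Nat.Properties as ℕ
open import Data.Product.Base using (∃; _,_; proj₁; proj₂)
open import Data.Sum.Base using (inj₁; inj₂; [_,_]′; map₂)
open import Data.Vec.Base using (_∷_; here; there)
open import Data.Vec.Properties using ([]=⇒lookup; lookup⇒[]=; lookup∘tabulate)
open import Function.Base using (_∘_)
open import Function.Bundles using (mk⇔; module Equivalence)
open import Function.Construct.Composition using (_⇔-∘_)
open import Induction.WellFounded using (module All)
open import Relation.Binary.PropositionalEquality
  using (_≢_; refl; sym; trans; cong; subst)
open import Relation.Nullary using (yes; no; contradiction)
open import Relation.Nullary.Construct.Add.Infimum using (⊥₋)
open import Relation.Nullary.Decidable
  using (_×-dec_; _→-dec_; dec-true; does; decidable-stable)
open import Relation.Binary.Construct.Add.Infimum.Strict using ([_])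
open import Relation.Unary using (Pred; Decidable)

private
  variable
    ℓ : Level
    n : ℕ
    i j : Fin n
    S T U : Subset n
    g h : Permutation′ n

-- Membership, removal and cardinality of subsets.

∈-comprehension⁺ : {P : Pred (Fin n) ℓ} (P? : Decidable P) →
                   ∀ {x} → P x → x ∈ comprehension P?
∈-comprehension⁺ P? {x} px =
  lookup⇒[]= x _ (trans (lookup∘tabulate _ x) (dec-true (P? x) px))

∈-comprehension⁻ : {P : Pred (Fin n) ℓ} (P? : Decidable P) →
                   ∀ {x} → x ∈ comprehension P? → P x
∈-comprehension⁻ P? {x} x∈
  with P? x | trans (sym (lookup∘tabulate (does ∘ P?) x)) ([]=⇒lookup x∈)
... | yes px | _  = px
... | no _   | ()

x∈q⇒x∉p─q : ∀ {p q : Subset n} {x} → x ∈ q → x ∉ p ─ q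
x∈q⇒x∉p─q {p = _ ∷ _} here        ()
x∈q⇒x∉p─q {p = _ ∷ _} (there x∈q) (there x∈p─q) = x∈q⇒x∉p─q x∈q x∈p─q

x∈p-y⇒x≢y : ∀ {p : Subset n} {x y} → x ∈ p - y → x ≢ y
x∈p-y⇒x≢y x∈p-x refl = x∈q⇒x∉p─q (x∈⁅x⁆ _) x∈p-x

x∈p-y⇒x∈p : ∀ {p : Subset n} {x y} → x ∈ p - y → x ∈ p
x∈p-y⇒x∈p = p─q⊆p _ _

⊆∧∣∣≡⇒≡ : S ⊆ T → ∣ S ∣ ≡ ∣ T ∣ → S ≡ T
⊆∧∣∣≡⇒≡ {S = S} S⊆T ∣S∣≡∣T∣ = ⊆-antisym S⊆T λ {x} x∈T →
  decidable-stable (x ∈? S) λ x∉S →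
    ℕ.<⇒≢ (p⊂q⇒∣p∣<∣q∣ (S⊆T , x , x∈T , x∉S)) ∣S∣≡∣T∣

∣∣≡⇒Nonempty : {S T : Subset n} → ∣ S ∣ ≡ ∣ T ∣ → Nonempty S → Nonempty T
∣∣≡⇒Nonempty {n = n} {S = S} {T = T} ∣S∣≡∣T∣ (x , x∈S) =
  decidable-stable (nonempty? T) λ T-empty →
    ℕ.n≮0 (subst (∣ S - x ∣ ℕ.<_)
      (trans ∣S∣≡∣T∣ (trans (cong ∣_∣ (Empty-unique T-empty)) (∣⊥∣≡0 n)))
      (x∈p⇒∣p-x∣<∣p∣ x∈S))

∁-initial⁺ : ∀ {m} → (∀ {x} → x ∈ S → m ℕ.≤ toℕ x) → S ⊆ ∁ (initial m)
∁-initial⁺ m≤ x∈S = x∉p⇒x∈∁p λ x∈init →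
  ℕ.≤⇒≯ (m≤ x∈S) (∈-comprehension⁻ (λ k → toℕ k ℕ.<? _) x∈init)

∁-initial⁻ : ∀ {m} {x : Fin n} → x ∈ ∁ (initial m) → m ℕ.≤ toℕ x
∁-initial⁻ x∈∁ = ℕ.≮⇒≥ (x∈∁p⇒x∉p x∈∁ ∘ ∈-comprehension⁺ (λ k → toℕ k ℕ.<? _))

⊆∁-initial⇒Lift : S ⊆ ∁ (initial (toℕ i)) → Lift (i ≤_) S
⊆∁-initial⇒Lift S⊆ x∈S = ∁-initial⁻ (S⊆ x∈S)

-- The lexicographic order.

≺⇒Nonemptyʳ : S ≺ T → Nonempty T
≺⇒Nonemptyʳ (∅≺ _ ne)             = ne
≺⇒Nonemptyʳ (min< _ (r∈T , _) _)  = _ , r∈T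
≺⇒Nonemptyʳ (min≡ _ (m∈T , _) _)  = _ , m∈T

IsMin-unique : ∀ {k l} → IsMin k S → IsMin l S → k ≡ l
IsMin-unique (k∈S , k≤) (l∈S , l≤) = ≤-antisym (k≤ l∈S) (l≤ k∈S)

Nonempty⇒IsMin : Nonempty S → ∃ λ k → IsMin k S
Nonempty⇒IsMin (zero , here) = zero , here , λ _ → ℕ.z≤n
Nonempty⇒IsMin {S = true ∷ S} (suc x , there x∈S) = zero , here , λ _ → ℕ.z≤n
Nonempty⇒IsMin {S = false ∷ S} (suc x , there x∈S)
  with k , k∈S , k≤ ← Nonempty⇒IsMin (x , x∈S) =
  suc k , there k∈S , λ { (there y∈S) → ℕ.s≤s (k≤ y∈S) }

≺-irrefl : S ≡ T → ¬ S ≺ T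
≺-irrefl refl (∅≺ S-empty S-nonempty)  = S-empty S-nonempty
≺-irrefl refl (min< s-min r-min s<r)     = <⇒≢ s<r (IsMin-unique s-min r-min)
≺-irrefl refl (min≡ _ _ S-m≺S-m)       = ≺-irrefl refl S-m≺S-m

-- `i` is the minimum of `T`, while the minimum of `S` is strictly larger because `S` lacks `i`.
∈-min⇒≺ : i ∈ T → Lift (i ≤_) T → Lift (i ≤_) S → i ∉ S → Nonempty S → T ≺ S
∈-min⇒≺ i∈T i≤T i≤S i∉S S-nonempty
  with r , r∈S , r≤ ← Nonempty⇒IsMin S-nonempty =
  min< (i∈T , i≤T) (r∈S , r≤) (≤∧≢⇒< (i≤S r∈S) λ { refl → i∉S r∈S })

-- Neither emptiness nor a smaller minimum can make `T` precede `S`, so only equal minima remain.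
IsMin-≺⇒ : IsMin i S → Lift (i ≤_) T → Nonempty T → T ≺ S →
           i ∈ T × T - i ≺ S - i
IsMin-≺⇒ _ _ T-nonempty (∅≺ T-empty _) = contradiction T-nonempty T-empty
IsMin-≺⇒ iS i≤T _ (min< (s∈T , _) rS s<r)
  with refl ← IsMin-unique iS rS = contradiction (i≤T s∈T) (ℕ.<⇒≱ s<r)
IsMin-≺⇒ iS _ _ (min≡ (m∈T , _) mS T-m≺S-m)
  with refl ← IsMin-unique iS mS = m∈T , T-m≺S-m

-- Images of subsets under permutations.

·⁺ : ∀ (g : Permutation′ n) {x} → x ∈ S → g ⟨$⟩ʳ x ∈ g · S
·⁺ {S = S} g {x} x∈S =
  ∈-comprehension⁺ (λ y → any? (λ s → (s ∈? S) ×-dec (g ⟨$⟩ʳ s ≟ y)))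
    (x , x∈S , refl)

·⁻ : ∀ (g : Permutation′ n) {y} → y ∈ g · S → ∃ λ x → x ∈ S × g ⟨$⟩ʳ x ≡ y
·⁻ {S = S} g =
  ∈-comprehension⁻ (λ y → any? (λ s → (s ∈? S) ×-dec (g ⟨$⟩ʳ s ≟ y)))

⟨$⟩ʳ-injective : ∀ (g : Permutation′ n) {x y} → g ⟨$⟩ʳ x ≡ g ⟨$⟩ʳ y → x ≡ y
⟨$⟩ʳ-injective g eq = trans (sym (inverseˡ g)) (trans (cong (flip g ⟨$⟩ʳ_) eq) (inverseˡ g))

·-cong : ∀ (g h : Permutation′ n) → (∀ x → g ⟨$⟩ʳ x ≡ h ⟨$⟩ʳ x) → g · S ≡ h · S
·-cong {S = S} g h g≈h = ⊆-antisym
  (λ y∈ → let x , x∈S , eq = ·⁻ g y∈ in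
          subst (_∈ h · S) (trans (sym (g≈h x)) eq) (·⁺ h x∈S))
  (λ y∈ → let x , x∈S , eq = ·⁻ h y∈ in
          subst (_∈ g · S) (trans (g≈h x) eq) (·⁺ g x∈S))

·-identity : ∀ (g : Permutation′ n) → IsTrivial g → g · S ≡ S
·-identity {S = S} g g≈id = ⊆-antisym
  (λ y∈ → let x , x∈S , eq = ·⁻ g y∈ in
          subst (_∈ S) (trans (sym (g≈id x)) eq) x∈S)
  (λ {x} x∈S → subst (_∈ g · S) (g≈id x) (·⁺ g x∈S))

·-∘ : ∀ (g h : Permutation′ n) → (g ∘ₚ h) · S ≡ h · (g · S)
·-∘ {S = S} g h = ⊆-antisym
  (λ y∈ → let x , x∈S , eq = ·⁻ (g ∘ₚ h) y∈ in
          subst (_∈ h · (g · S)) eq (·⁺ h (·⁺ g x∈S)))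
  (λ z∈ → let y , y∈ , hy≡z = ·⁻ h z∈
              x , x∈S , gx≡y = ·⁻ g y∈ in
          subst (_∈ (g ∘ₚ h) · S) (trans (cong (h ⟨$⟩ʳ_) gx≡y) hy≡z)
            (·⁺ (g ∘ₚ h) x∈S))

-- Injectivity keeps the other elements of `S` from being mapped to `g ⟨$⟩ʳ j`.
·-remove : ∀ (g : Permutation′ n) → g · (S - j) ≡ g · S - (g ⟨$⟩ʳ j)
·-remove {S = S} {j = j} g = ⊆-antisym
  (λ y∈ → let x , x∈S-j , eq = ·⁻ g y∈ in
    subst (_∈ g · S - (g ⟨$⟩ʳ j)) eq
      (x∈p∧x≢y⇒x∈p-y (·⁺ g (x∈p-y⇒x∈p x∈S-j))
        (x∈p-y⇒x≢y x∈S-j ∘ ⟨$⟩ʳ-injective g)))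
  (λ y∈ → let x , x∈S , eq = ·⁻ g (x∈p-y⇒x∈p y∈) in
    subst (_∈ g · (S - j)) eq
      (·⁺ g (x∈p∧x≢y⇒x∈p-y x∈S λ x≡j →
        x∈p-y⇒x≢y y∈ (trans (sym eq) (cong (g ⟨$⟩ʳ_) x≡j)))))

·-Nonempty : ∀ (g : Permutation′ n) → Nonempty S → Nonempty (g · S)
·-Nonempty g (x , x∈S) = g ⟨$⟩ʳ x , ·⁺ g x∈S

-- The maximum of a subset.

max-∈ : j ∈ S → ∃ λ k → max S ≡ [ k ] × j ≤ k
max-∈ {S = _ ∷ S} here with max S
... | [ k ] = suc k , refl , ℕ.z≤n
... | ⊥₋    = zero , refl , ℕ.z≤n
max-∈ {S = _ ∷ S} (there j∈S) with max S | max-∈ j∈S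
... | _ | k , refl , j≤k = suc k , refl , ℕ.s≤s j≤k

-- An element of `S` forces `max S` to be a proper value, so the comparison takes place in `Fin n`.
max<⇒< : max S <₋ [ i ] → j ∈ S → j < i
max<⇒< max<i j∈S with max-∈ j∈S
... | k , eq , j≤k with [ k<i ] ← subst (_<₋ [ _ ]) eq max<i = ℕ.≤-<-trans j≤k k<i

-- Point-wise stabilizers.

module _ (G : Subgroup n ℓ) where
  open Subgroup G using (id-closed; ∘-closed; ⁻¹-closed)

  id∈Stabilizer : ∀ {m} → Stabilizer G m id
  id∈Stabilizer = id-closed , λ _ _ → refl

  ∘∈Stabilizer : ∀ {m} → Stabilizer G m g → Stabilizer G m h →
                 Stabilizer G m (g ∘ₚ h)
  ∘∈Stabilizer {h = h} (g∈G , g-fix) (h∈G , h-fix) = ∘-closed g∈G h∈G ,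
    λ k k<m → trans (cong (h ⟨$⟩ʳ_) (g-fix k k<m)) (h-fix k k<m)

  ⁻¹∈Stabilizer : ∀ {m} → Stabilizer G m g → Stabilizer G m (flip g)
  ⁻¹∈Stabilizer {g = g} (g∈G , g-fix) = ⁻¹-closed g∈G ,
    λ k k<m → trans (cong (flip g ⟨$⟩ʳ_) (sym (g-fix k k<m))) (inverseˡ g)

  Stabilizer-suc : Stabilizer G (toℕ i) g → g ⟨$⟩ʳ i ≡ i →
                   Stabilizer G (ℕ.suc (toℕ i)) g
  Stabilizer-suc {i = i} {g = g} (g∈G , g-fix) gi≡i = g∈G , fix
    where
    fix : ∀ k → toℕ k ℕ.< ℕ.suc (toℕ i) → g ⟨$⟩ʳ k ≡ k
    fix k k<1+i with k ≟ i
    ... | yes refl = gi≡i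
    ... | no k≢i   = g-fix k (≤∧≢⇒< (ℕ.≤-pred k<1+i) k≢i)

  Stabilizer-pred : Stabilizer G (ℕ.suc (toℕ i)) g → Stabilizer G (toℕ i) g
  Stabilizer-pred (g∈G , g-fix) = g∈G , λ k k<i → g-fix k (ℕ.m<n⇒m<1+n k<i)

  -- If `g` sent `k` to a value below `i`, it would also fix that value; by injectivity `k` would
  -- equal it and lie below `i`.
  Stabilizer-≤ : ∀ {k} → Stabilizer G (toℕ i) g → i ≤ k → i ≤ g ⟨$⟩ʳ k
  Stabilizer-≤ {i = i} {g = g} {k} (_ , g-fix) i≤k = ℕ.≮⇒≥ λ gk<i →
    ℕ.<⇒≱ gk<i (subst (λ l → toℕ i ℕ.≤ toℕ l)
      (sym (⟨$⟩ʳ-injective g (g-fix _ gk<i))) i≤k)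

  Lift-· : Stabilizer G (toℕ i) g → Lift (i ≤_) S → Lift (i ≤_) (g · S)
  Lift-· {i = i} {g = g} g∈ i≤S y∈ =
    let x , x∈S , eq = ·⁻ g y∈ in subst (i ≤_) eq (Stabilizer-≤ g∈ (i≤S x∈S))

  CanPrecede-∘ : Stabilizer G (toℕ i) h →
                 CanPrecede (Stabilizer G (ℕ.suc (toℕ i))) (h · T) U →
                 CanPrecede (Stabilizer G (toℕ i)) T U
  CanPrecede-∘ {h = h} h∈ (g′ , g′∈ , lt) =
    h ∘ₚ g′ , ∘∈Stabilizer h∈ (Stabilizer-pred g′∈) ,
    subst (_≺ _) (sym (·-∘ h g′)) lt

  CanPrecede-∘⁻¹ : Stabilizer G (toℕ i) h → h ⟨$⟩ʳ j ≡ i →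
                   Stabilizer G (toℕ i) g → g ⟨$⟩ʳ j ≡ i → g · T ≺ U →
                   CanPrecede (Stabilizer G (ℕ.suc (toℕ i))) (h · T) U
  CanPrecede-∘⁻¹ {h = h} {g = g} h∈ hj≡i g∈ gj≡i lt =
    flip h ∘ₚ g ,
    -- The inverse of `h` takes `i` to `j` and `g` takes `j` back to `i`, so the composite fixes `i`
    -- too.
    Stabilizer-suc (∘∈Stabilizer (⁻¹∈Stabilizer h∈) g∈)
      (trans (cong (λ k → g ⟨$⟩ʳ (flip h ⟨$⟩ʳ k)) (sym hj≡i))
        (trans (cong (g ⟨$⟩ʳ_) (inverseˡ h)) gj≡i)) ,
    subst (_≺ _)
      -- Inserting `h` and its inverse before `g` exhibits `g · T` as an image of `h · T`.
      (trans (·-cong g (h ∘ₚ flip h ∘ₚ g) (λ x → cong (g ⟨$⟩ʳ_) (sym (inverseˡ h))))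
        (·-∘ h (flip h ∘ₚ g)))
      lt

  -- Since `h ∘ₚ g′` sends `j` to `i`, both sets have minimum `i`, and what is left after removing
  -- it is the given comparison.
  CanPrecede-remove : Stabilizer G (toℕ i) h → h ⟨$⟩ʳ j ≡ i → j ∈ T →
                      Lift (i ≤_) T → IsMin i S →
                      CanPrecede (Stabilizer G (ℕ.suc (toℕ i))) (h · (T - j)) (S - i) →
                      CanPrecede (Stabilizer G (toℕ i)) T S
  CanPrecede-remove {i = i} {h = h} h∈ hj≡i j∈T i≤T iS (g′ , g′∈ , lt) =
    f , f∈ ,
    min≡ (subst (_∈ f · _) fj≡i (·⁺ f j∈T) , Lift-· f∈ i≤T) iS
      (subst (_≺ _)
        (trans (sym (·-∘ h g′)) (trans (·-remove f) (cong (f · _ -_) fj≡i))) lt)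
    where
    f : Permutation′ n
    f = h ∘ₚ g′
    f∈ : Stabilizer G (toℕ i) f
    f∈ = ∘∈Stabilizer h∈ (Stabilizer-pred g′∈)
    -- The bound `suc (toℕ i)` includes `i` itself, so `g′` fixes `i`.
    fj≡i : f ⟨$⟩ʳ _ ≡ i
    fj≡i = trans (cong (g′ ⟨$⟩ʳ_) hj≡i) (proj₂ g′∈ _ (ℕ.n<1+n _))

  -- `h` alone suffices: it brings `i` into the image of `T`, and all elements of `S` are larger
  -- than `i`.
  CanPrecede-of-∈ : Stabilizer G (toℕ i) h → h ⟨$⟩ʳ j ≡ i → j ∈ T →
                    Lift (i ≤_) T → Lift (i ≤_) S → i ∉ S → Nonempty S →
                    CanPrecede (Stabilizer G (toℕ i)) T S
  CanPrecede-of-∈ {h = h} h∈ hj≡i j∈T i≤T i≤S i∉S S-nonempty =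
    h , h∈ , ∈-min⇒≺ (subst (_∈ h · _) hj≡i (·⁺ h j∈T)) (Lift-· h∈ i≤T) i≤S i∉S S-nonempty

-- Switches and effective rows.

module _ {G : Subgroup n ℓ} (σ : SwitchTable G) where
  open SwitchTable σ

  -- Required is not decidable, but the property it yields for a switch is.
  nonTrivial⇒mapsFixingBelow : NonTrivialAt i j → MapsFixingBelow i j (switch i j)
  nonTrivial⇒mapsFixingBelow {i = i} {j = j} nt =
    decidable-stable
      ((switch i j ⟨$⟩ʳ j ≟ i) ×-dec
       all? (λ k → (toℕ k ℕ.<? toℕ i) →-dec (switch i j ⟨$⟩ʳ k ≟ k)))
      λ ¬maps → nt (otherwise (¬maps ∘ required))

  -- Trivial switches are covered as well, since `Out-d` admits them.
  switch∈Stabilizer : ∀ i j → Stabilizer G (toℕ i) (switch i j)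
  switch∈Stabilizer i j = member i j , fix
    where
    fix : ∀ k → toℕ k ℕ.< toℕ i → switch i j ⟨$⟩ʳ k ≡ k
    fix k k<i with isTrivial? (switch i j)
    ... | yes tr = tr k
    ... | no nt  = proj₂ (nonTrivial⇒mapsFixingBelow nt) k k<i

  -- For `j` other than `i`, `g` itself witnesses that the table must provide a switch taking `j` to
  -- `i`, and such a switch is not the identity.
  preimage-of-row : Stabilizer G (toℕ i) g → g ⟨$⟩ʳ j ≡ i → i ≡ j ⊎ NonTrivialAt i j
  preimage-of-row {i = i} {g = g} {j = j} g∈@(g∈G , g-fix) gj≡i with i ≟ j
  ... | yes i≡j = inj₁ i≡j
  ... | no i≢j  = inj₂ λ tr → i≢j (trans (sym (proj₁ maps)) (tr j))
    where
    -- The inverse of `g` is in the stabilizer too and takes `i` to `j`.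
    i≤j : i ≤ j
    i≤j = subst (i ≤_) (trans (cong (flip g ⟨$⟩ʳ_) (sym gj≡i)) (inverseˡ g))
            (Stabilizer-≤ G (⁻¹∈Stabilizer G g∈) ℕ.≤-refl)
    maps : MapsFixingBelow i j (switch i j)
    maps = required (≤∧≢⇒< i≤j i≢j , g , g∈G , gj≡i , g-fix)

  -- Strong induction on `k`: if `g` fixes everything below `k`, then either `g` fixes `k` or row
  -- `k` has a non-trivial switch. For `k` at least `i` the latter would be an effective row beyond
  -- the maximum.
  Stabilizer-trivial : max effectiveRows <₋ [ i ] → Stabilizer G (toℕ i) g → IsTrivial g
  Stabilizer-trivial {i = i} {g = g} max<i (g∈G , g-fix) =
    All.wfRec <-wellFounded _ (λ k → g ⟨$⟩ʳ k ≡ k) step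
    where
    step : ∀ k → (∀ {l} → l < k → g ⟨$⟩ʳ l ≡ l) → g ⟨$⟩ʳ k ≡ k
    step k fix with toℕ k ℕ.<? toℕ i
    ... | yes k<i = g-fix k k<i
    ... | no k≮i
      with preimage-of-row {i = k} (g∈G , λ _ → fix) (inverseʳ g)
    ...   | inj₁ k≡j = trans (cong (g ⟨$⟩ʳ_) k≡j) (inverseʳ g)
    ...   | inj₂ nt  = contradiction
      (max<⇒< max<i (∈-comprehension⁺ (λ l → any? (nonTrivialAt? l)) (_ , nt))) k≮i

  -- The four statements for a fixed row.

  module _ {i : Fin n} {S S′ : Subset n}
           (i≤S : Lift (i ≤_) S) (i≤S′ : Lift (i ≤_) S′) (∣S∣≡∣S′∣ : ∣ S ∣ ≡ ∣ S′ ∣) where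

    private
      Gᵢ₋₁ : Pred (Permutation′ n) ℓ
      Gᵢ₋₁ = Stabilizer G (toℕ i)

    -- Nothing precedes the empty set. If `S` is the whole tail from `i` on, cardinality makes `S′`
    -- the same set, and the stabilizer maps the tail onto itself.
    extremal : S ≡ ⊥ ⊎ S ≡ ∁ (initial (toℕ i)) → ¬ CanPrecede Gᵢ₋₁ S′ S
    extremal (inj₁ refl) (_ , _ , lt) = ∉⊥ (proj₂ (≺⇒Nonemptyʳ lt))
    extremal (inj₂ S≡∁) (g , g∈ , lt) = ≺-irrefl g·S′≡S lt
      where
      tail⊆S : Lift (i ≤_) T → T ⊆ S
      tail⊆S {T = T} i≤T = subst (T ⊆_) (sym S≡∁) (∁-initial⁺ i≤T)
      S⊆S′ : S ⊆ S′
      S⊆S′ {x} = subst (x ∈_) (sym (⊆∧∣∣≡⇒≡ (tail⊆S i≤S′) (sym ∣S∣≡∣S′∣)))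
      g·S′≡S : g · S′ ≡ S
      g·S′≡S = ⊆-antisym (tail⊆S (Lift-· G g∈ i≤S′)) λ x∈S →
        subst (_∈ g · S′) (inverseʳ g)
          (·⁺ g (S⊆S′ (tail⊆S (Lift-· G (⁻¹∈Stabilizer G g∈) i≤S) (·⁺ (flip g) x∈S))))

    -- Either assumption leaves only the identity in the stabilizer.
    trivial : IsTrivialGroup G ⊎ max effectiveRows <₋ [ i ] →
              CanPrecede Gᵢ₋₁ S′ S ⇔ S′ ≺ S
    trivial triv = mk⇔
      (λ { (g , g∈ , lt) → subst (_≺ S) (·-identity g (g-trivial g∈)) lt })
      (λ lt → id , id∈Stabilizer G , subst (_≺ S) (sym (·-identity id λ _ → refl)) lt)
      where
      g-trivial : Gᵢ₋₁ g → IsTrivial g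
      g-trivial g∈ = [ (λ G-trivial → G-trivial (proj₁ g∈)) ,
                       (λ max<i → Stabilizer-trivial max<i g∈) ]′ triv

    -- `i` is the minimum of `S` and a lower bound of the image of `S′`, so the image can precede
    -- `S` only by containing `i`; the decision then passes to the sets without `i`.
    in-case : i ∈ S → CanPrecede Gᵢ₋₁ S′ S ⇔ InCases σ i S S′
    in-case i∈S = mk⇔ to from
      where
      to : CanPrecede Gᵢ₋₁ S′ S → InCases σ i S S′
      to (g , g∈ , lt)
        -- Equal cardinality makes `S′` nonempty along with `S`.
        with i∈g·S′ , lt′ ← IsMin-≺⇒ (i∈S , i≤S) (Lift-· G g∈ i≤S′)
               (·-Nonempty g (∣∣≡⇒Nonempty ∣S∣≡∣S′∣ (i , i∈S))) lt
        with j , j∈S′ , gj≡i ← ·⁻ g i∈g·S′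
        -- Removing `i` from the image amounts to removing `j` beforehand.
        with lt″ ← subst (_≺ S - i)
               (sym (trans (·-remove g) (cong (g · S′ -_) gj≡i))) lt′
        -- If `j` is `i`, then `g` fixes `i` and serves for (a); otherwise dividing `g` by the
        -- switch gives (b).
        with preimage-of-row g∈ gj≡i
      ... | inj₁ refl = inj₁ (j∈S′ , g , Stabilizer-suc G g∈ gj≡i , lt″)
      ... | inj₂ nt   = inj₂ (j , nt , j∈S′ ,
        CanPrecede-∘⁻¹ G (switch∈Stabilizer i j)
          (proj₁ (nonTrivial⇒mapsFixingBelow nt)) g∈ gj≡i lt″)
      from : InCases σ i S S′ → CanPrecede Gᵢ₋₁ S′ S
      -- Handled like (b), with the identity in place of the switch.
      from (inj₁ (i∈S′ , pr)) =
        CanPrecede-remove G (id∈Stabilizer G) refl i∈S′ i≤S′ (i∈S , i≤S)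
          (subst (λ T → CanPrecede _ T (S - i)) (sym (·-identity id λ _ → refl)) pr)
      from (inj₂ (j , nt , j∈S′ , pr)) =
        CanPrecede-remove G (switch∈Stabilizer i j)
          (proj₁ (nonTrivial⇒mapsFixingBelow nt)) j∈S′ i≤S′ (i∈S , i≤S) pr

    -- With `j` the element that `g` takes to `i`, the four cases correspond to whether `j` is `i`
    -- and whether `j` lies in `S′`.
    out-case : i ∉ S → CanPrecede Gᵢ₋₁ S′ S ⇔ OutCases σ i S S′
    out-case i∉S = mk⇔ to from
      where
      to : CanPrecede Gᵢ₋₁ S′ S → OutCases σ i S S′
      -- `j` is abstracted together with its equation, so that `i ≡ j` can be matched with `refl`.
      to (g , g∈ , lt) with flip g ⟨$⟩ʳ i | inverseʳ g {i}
      ... | j | gj≡i with preimage-of-row g∈ gj≡i | j ∈? S′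
      ...   | inj₁ refl | yes i∈S′ = inj₁ i∈S′
      ...   | inj₁ refl | no _     =
        inj₂ (inj₂ (inj₁ (g , Stabilizer-suc G g∈ gj≡i , lt)))
      ...   | inj₂ nt   | yes j∈S′ =
        inj₂ (inj₁ (j , x∈p∩q⁺ (∈-comprehension⁺ (nonTrivialAt? i) nt , j∈S′)))
      ...   | inj₂ nt   | no j∉S′  =
        inj₂ (inj₂ (inj₂ (j , j∉S′ ,
          CanPrecede-∘⁻¹ G (switch∈Stabilizer i j)
            (proj₁ (nonTrivial⇒mapsFixingBelow nt)) g∈ gj≡i lt)))

      -- Serves (a) with the identity and (b) with a switch; `j` makes `S′`, and hence `S`,
      -- nonempty.
      moveTo-i : ∀ {h j} → Gᵢ₋₁ h → h ⟨$⟩ʳ j ≡ i → j ∈ S′ → CanPrecede Gᵢ₋₁ S′ S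
      moveTo-i h∈ hj≡i j∈S′ = CanPrecede-of-∈ G h∈ hj≡i j∈S′ i≤S′ i≤S i∉S
        (∣∣≡⇒Nonempty (sym ∣S∣≡∣S′∣) (_ , j∈S′))

      from : OutCases σ i S S′ → CanPrecede Gᵢ₋₁ S′ S
      from (inj₁ i∈S′) = moveTo-i (id∈Stabilizer G) refl i∈S′
      from (inj₂ (inj₁ (j , j∈)))
        with j∈C , j∈S′ ← x∈p∩q⁻ (effectiveColumns i) S′ j∈ =
        moveTo-i (switch∈Stabilizer i j)
          (proj₁ (nonTrivial⇒mapsFixingBelow (∈-comprehension⁻ (nonTrivialAt? i) j∈C)))
          j∈S′
      from (inj₂ (inj₂ (inj₁ (g , g∈ , lt)))) = g , Stabilizer-pred G g∈ , lt
      from (inj₂ (inj₂ (inj₂ (j , _ , pr)))) =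
        CanPrecede-∘ G (switch∈Stabilizer i j) pr

-- Assembly for all rows and for the first row.

lemma5 : {ℓ : Level} {n : ℕ} (G : Subgroup n ℓ) (σ : SwitchTable G) →
  let open SwitchTable σ using (effectiveRows) in
  ((i : Fin n) (S S′ : Subset n) →
    let Gᵢ₋₁ = Stabilizer G (toℕ i) in
    S ⊆ ∁ (initial (toℕ i)) →
    S′ ⊆ ∁ (initial (toℕ i)) →
    ∣ S ∣ ≡ ∣ S′ ∣ →
    -- (i)
    (S ≡ ⊥ ⊎ S ≡ ∁ (initial (toℕ i)) → ¬ CanPrecede Gᵢ₋₁ S′ S) ×
    -- (ii)
    (IsTrivialGroup G ⊎ max effectiveRows <₋ [ i ] →
      CanPrecede Gᵢ₋₁ S′ S ⇔ S′ ≺ S) ×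
    -- (iii)
    (i ∈ S →
      (InCases σ i S S′ → CanPrecede Gᵢ₋₁ S′ S) ×
      (¬ InCases σ i S S′ → ¬ CanPrecede Gᵢ₋₁ S′ S)) ×
    -- (iv)
    (i ∉ S →
      (OutCases σ i S S′ → CanPrecede Gᵢ₋₁ S′ S) ×
      (¬ OutCases σ i S S′ → ¬ CanPrecede Gᵢ₋₁ S′ S)))
  ×
  -- the characterization for the first row and S′ = S
  ((i : Fin n) → toℕ i ≡ 0 → (S : Subset n) →
    (S ≡ ⊥ ⊎ S ≡ ⊤ → ¬ CanPrecede (Member G) S S) ×
    (IsTrivialGroup G ⊎ max effectiveRows <₋ [ i ] →
      CanPrecede (Member G) S S ⇔ S ≺ S) ×
    (i ∈ S → CanPrecede (Member G) S S ⇔ InCases σ i S S) ×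
    (i ∉ S → CanPrecede (Member G) S S ⇔ OutCases σ i S S))
lemma5 {ℓ} {n} G σ = rows , firstRow
  where
  open SwitchTable σ using (effectiveRows)

  rows : (i : Fin n) (S S′ : Subset n) →
    let Gᵢ₋₁ = Stabilizer G (toℕ i) in
    S ⊆ ∁ (initial (toℕ i)) →
    S′ ⊆ ∁ (initial (toℕ i)) →
    ∣ S ∣ ≡ ∣ S′ ∣ →
    (S ≡ ⊥ ⊎ S ≡ ∁ (initial (toℕ i)) → ¬ CanPrecede Gᵢ₋₁ S′ S) ×
    (IsTrivialGroup G ⊎ max effectiveRows <₋ [ i ] →
      CanPrecede Gᵢ₋₁ S′ S ⇔ S′ ≺ S) ×
    (i ∈ S →
      (InCases σ i S S′ → CanPrecede Gᵢ₋₁ S′ S) ×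
      (¬ InCases σ i S S′ → ¬ CanPrecede Gᵢ₋₁ S′ S)) ×
    (i ∉ S →
      (OutCases σ i S S′ → CanPrecede Gᵢ₋₁ S′ S) ×
      (¬ OutCases σ i S S′ → ¬ CanPrecede Gᵢ₋₁ S′ S))
  rows i S S′ S⊆ S′⊆ ∣S∣≡∣S′∣ =
    extremal σ i≤S i≤S′ ∣S∣≡∣S′∣ ,
    trivial σ i≤S i≤S′ ∣S∣≡∣S′∣ ,
    -- The second half is the contrapositive of `to`; likewise in (iv).
    (λ i∈S → let open Equivalence (in-case σ i≤S i≤S′ ∣S∣≡∣S′∣ i∈S) in
             from , (_∘ to)) ,
    (λ i∉S → let open Equivalence (out-case σ i≤S i≤S′ ∣S∣≡∣S′∣ i∉S) in
             from , (_∘ to))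
    where
    i≤S : Lift (i ≤_) S
    i≤S = ⊆∁-initial⇒Lift S⊆
    i≤S′ : Lift (i ≤_) S′
    i≤S′ = ⊆∁-initial⇒Lift S′⊆

  CanPrecede-G⇔G₀ : CanPrecede (Member G) T U ⇔ CanPrecede (Stabilizer G 0) T U
  CanPrecede-G⇔G₀ = mk⇔ (λ { (g , g∈G , lt) → g , (g∈G , λ _ ()) , lt })
                        (λ { (g , (g∈G , _) , lt) → g , g∈G , lt })

  firstRow : (i : Fin n) → toℕ i ≡ 0 → (S : Subset n) →
    (S ≡ ⊥ ⊎ S ≡ ⊤ → ¬ CanPrecede (Member G) S S) ×
    (IsTrivialGroup G ⊎ max effectiveRows <₋ [ i ] →
      CanPrecede (Member G) S S ⇔ S ≺ S) ×
    (i ∈ S → CanPrecede (Member G) S S ⇔ InCases σ i S S) ×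
    (i ∉ S → CanPrecede (Member G) S S ⇔ OutCases σ i S S)
  -- With `i` matched as `zero`, `toℕ i` computes to 0, so the results for this row speak of
  -- `Stabilizer G 0`, which is all of `G`.
  firstRow i@zero refl S =
    (λ S≡ → extremal σ 0≤S 0≤S refl (map₂ (λ S≡⊤ → trans S≡⊤ ⊤≡∁initial) S≡)
            ∘ Equivalence.to CanPrecede-G⇔G₀) ,
    (λ triv → trivial σ 0≤S 0≤S refl triv ⇔-∘ CanPrecede-G⇔G₀) ,
    (λ 0∈S → in-case σ 0≤S 0≤S refl 0∈S ⇔-∘ CanPrecede-G⇔G₀) ,
    (λ 0∉S → out-case σ 0≤S 0≤S refl 0∉S ⇔-∘ CanPrecede-G⇔G₀)
    where
    0≤S : Lift (i ≤_) S
    0≤S _ = ℕ.z≤n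
    ⊤≡∁initial : ⊤ ≡ ∁ (initial 0)
    ⊤≡∁initial = ⊆-antisym (∁-initial⁺ λ _ → ℕ.z≤n) ⊆⊤
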